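{- Let $(S,+)$ be an infinite semigroup which is left weakly cancellative and has no idempotent element. Let $A\subseteq S$ be an IP set. Then $A$ can be partitioned into countably infinitely many pairwise disjoint sets, each of which is an IP set in $S$.
   Context: A semigroup $(S,+)$ is left weakly cancellative if for all $a,b\in S$ the set $\{x\in S: a+x=b\}$ is finite. An element $e$ is idempotent if $e+e=e$. For a sequence $\langle x_n\rangle_{n=1}^\infty$ in $S$, $\mathrm{FS}(\langle x_n\rangle_{n=1}^\infty)=\{\sum_{n\in H}x_n : H\text{ a nonempty finite subset of }\mathbb{N}\}$, where sums are taken in increasing order of indices. A set $A\subseteq S$ is an IP set if there is a sequence $\langle x_n\rangle_{n=1}^\infty$ in $S$ with $\mathrm{FS}(\langle x_n\rangle_{n=1}^\infty)\subseteq A$. -}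

module Defs where

open import Algebra.Bundles using (Semigroup)
open import Level using (Level; 0ℓ; _⊔_)
open import Data.List.Base using (List)
open import Data.List.NonEmpty.Base using (List⁺; foldr₁; map; toList)
open import Data.List.Relation.Unary.Linked using (Linked)
open import Data.Nat.Base using (ℕ; _<_)
open import Data.Product.Base using (_×_; ∃-syntax)
open import Relation.Binary.Definitions using (_Respects_)
open import Relation.Binary.PropositionalEquality.Core using (_≢_)
open import Relation.Nullary.Negation.Core using (¬_)
open import Relation.Unary using (Pred; U; _⊆_; _≐_; _⊥_; ⋃)

-- A subset of the semigroup is a predicate that respects _≈_. This is required
-- explicitly for the sets A and B i occurring in the theorem; the other
-- predicates below respect _≈_ by construction.

module _ {c ℓ : Level} (S : Semigroup c ℓ) where

  open Semigroup S
  open import Algebra.Definitions _≈_ using (_IdempotentOn_)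
  open import Data.List.Membership.Setoid setoid using (_∈_)

  Finite : ∀ {p} → Pred Carrier p → Set (c ⊔ ℓ ⊔ p)
  Finite P = ∃[ xs ] P ≐ (_∈ xs)

  Infinite : Set (c ⊔ ℓ)
  Infinite = ¬ Finite U

  LeftWeaklyCancellative : Set (c ⊔ ℓ)
  LeftWeaklyCancellative = ∀ a b → Finite (λ x → a ∙ x ≈ b)

  NoIdempotent : Set (c ⊔ ℓ)
  NoIdempotent = ∀ e → ¬ (_∙_ IdempotentOn e)

  -- Nonempty finite subsets of ℕ are encoded as nonempty strictly increasing
  -- lists, so that folding along the list sums in increasing order of indices.
  -- Sequences are indexed from 0.
  Increasing : Pred (List⁺ ℕ) 0ℓ
  Increasing H = Linked _<_ (toList H)

  FS : (ℕ → Carrier) → Pred Carrier ℓ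
  FS x y = ∃[ H ] Increasing H × y ≈ foldr₁ _∙_ (map x H)

  IsIP : ∀ {p} → Pred Carrier p → Set (c ⊔ ℓ ⊔ p)
  IsIP A = ∃[ x ] FS x ⊆ A

  -- Nonemptiness of the parts is not included: in the theorem every part is an
  -- IP set, hence nonempty, so that the parts are also pairwise distinct.
  record IsPartition {p q} (A : Pred Carrier p) (B : ℕ → Pred Carrier q)
                     : Set (c ⊔ ℓ ⊔ p ⊔ q) where
    field
      respects : ∀ i → B i Respects _≈_
      disjoint : ∀ {i j} → i ≢ j → B i ⊥ B j
      union    : A ≐ ⋃ ℕ B

{-# OPTIONS --safe #-}
-- Pass to a sequence y of sums over successive blocks of the given sequence
-- such that the value of a finite sum of y determines its largest index. Sums
-- along disjoint sets of indices then have disjoint values, so it suffices to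
-- split ℕ into infinitely many infinite classes. To choose the next term y n
-- one has to avoid the finitely many earlier sums b and, by left weak
-- cancellativity, the finitely many solutions of a + z = b with earlier sums a
-- and b. This is possible unless the sums over some tail of the given sequence
-- lie in a finite set. But then some a is a sum over every tail; such elements
-- are closed under addition, so all multiples of a lie in a finite set, and one
-- of them is idempotent.
module Submission where

open import Defs
open import Algebra.Bundles using (Semigroup)
open import Axiom.DoubleNegationElimination using (em⇒dne)
open import Axiom.ExcludedMiddle using (ExcludedMiddle)
open import Data.Fin.Base using (toℕ)
open import Data.Fin.Properties using (pigeonhole)
open import Data.List.Base using (List; []; _∷_; _++_; map; concatMap; length)
open import Data.List.NonEmpty.Base as List⁺ using (_∷_; foldr₁)
open import Data.List.Relation.Unary.Any as Any using (here; there)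
open import Data.List.Relation.Unary.Any.Properties using (++⁺ˡ; ++⁺ʳ; map⁺; concatMap⁺)
open import Data.List.Relation.Unary.Linked using ([-]; _∷_)
open import Data.Nat.Base
  using (ℕ; zero; suc; _+_; _*_; _∸_; _≤_; _<_; _≤′_; _<′_; z≤n; s<s; ≤′-refl; ≤′-step)
  renaming (_⊔_ to _⊔ℕ_)
open import Data.Nat.Properties
open import Data.Product.Base using (Σ-syntax; ∃-syntax; _×_; _,_; proj₁; proj₂)
open import Function.Base using (_∘_)
open import Level using (Level; _⊔_; Lift; lift; lower)
open import Relation.Binary.Definitions using (_Respects_; tri<; tri≈; tri>)
open import Relation.Binary.PropositionalEquality as ≡ using (_≡_; _≢_; refl; cong; subst)
open import Relation.Nullary.Decidable using (yes; no; map′)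
open import Relation.Nullary.Negation using (¬_; contradiction)
open import Relation.Unary using (Pred; _⊥_)

lower-em : ∀ {p} q → ExcludedMiddle (p ⊔ q) → ExcludedMiddle p
lower-em q em {P} = map′ lower lift (em {Lift q P})

-- Infinitely many disjoint infinite classes of indices

-- This is 2^i (2j + 1), so `i` is recovered as the exponent of 2. The index 0 lies in no class.
class : ℕ → ℕ → ℕ
class zero    j = suc (2 * j)
class (suc i) j = 2 * class i j

class-mono-< : ∀ i {j k} → j < k → class i j < class i k
class-mono-< zero    j<k = s<s (*-monoʳ-< 2 j<k)
class-mono-< (suc i) j<k = *-monoʳ-< 2 (class-mono-< i j<k)

class-injective : ∀ i i′ {j j′} → class i j ≡ class i′ j′ → i ≡ i′
class-injective zero    zero              eq = refl
class-injective zero    (suc i′) {j} {j′} eq = contradiction (≡.sym eq) (even≢odd (class i′ j′) j)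
class-injective (suc i) zero     {j} {j′} eq = contradiction eq (even≢odd (class i j) j′)
class-injective (suc i) (suc i′)          eq = cong suc (class-injective i i′ (*-cancelˡ-≡ _ _ 2 eq))

module _ {c ℓ : Level} (S : Semigroup c ℓ) where

  open Semigroup S renaming (refl to ≈-refl; sym to ≈-sym; trans to ≈-trans)
  open import Data.List.Membership.Setoid setoid using (_∈_; _∉_)
  open import Data.List.Membership.Setoid.Properties using (∈-resp-≈; index-injective)

  -- Multiples of an element and idempotents

  -- power a n is the sum of n + 1 copies of a.
  power : Carrier → ℕ → Carrier
  power a zero    = a
  power a (suc n) = a ∙ power a n

  power-+ : ∀ a m n → power a (suc (m + n)) ≈ power a m ∙ power a n
  power-+ a zero    n = ≈-refl
  power-+ a (suc m) n = ≈-trans (∙-congˡ (power-+ a m n)) (≈-sym (assoc _ _ _))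

  power-periodic : ∀ a {i j} → power a i ≈ power a j →
                   ∀ n → power a (n + i) ≈ power a (n + j)
  power-periodic a eq zero    = eq
  power-periodic a eq (suc n) = ∙-congˡ (power-periodic a eq n)

  -- From exponent `i` on, the powers repeat with period `j - i`; a large enough multiple of `a`
  -- whose count is divisible by the period is unchanged by doubling.
  power-idempotent : ∀ a {i j} → i < j → power a i ≈ power a j → ∃[ e ] e ∙ e ≈ e
  power-idempotent a {i} {j} i<j eq =
    -- `suc i * suc d` unfolds to `suc e`, so doubling the count `e + 1` shifts by `suc i` full
    -- periods.
    power a e , ≈-trans (≈-sym (power-+ a e e)) (shift (suc i))
    where
    -- e + 1 = (i + 1) (d + 1) is a multiple of the period d + 1 = j - i.
    d e : ℕ
    d = j ∸ suc i
    e = d + i * suc d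

    i≤e : i ≤ e
    i≤e = ≤-trans (m≤m*n i (suc d)) (m≤n+m _ d)

    j≡ : suc d + i ≡ j
    j≡ = ≡.trans (≡.sym (+-suc d i)) (m∸n+n≡m i<j)

    period : ∀ n → i ≤ n → power a (suc d + n) ≈ power a n
    period n i≤n = ≈-sym (≡.subst₂ (λ u v → power a u ≈ power a v) (m∸n+n≡m i≤n) eq′
                          (power-periodic a eq (n ∸ i)))
      where
      open ≡.≡-Reasoning
      eq′ : n ∸ i + j ≡ suc d + n
      eq′ = begin
        n ∸ i + j             ≡⟨ cong (n ∸ i +_) j≡ ⟨
        n ∸ i + (suc d + i)   ≡⟨ cong (n ∸ i +_) (+-comm (suc d) i) ⟩
        n ∸ i + (i + suc d)   ≡⟨ +-assoc (n ∸ i) i (suc d) ⟨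
        n ∸ i + i + suc d     ≡⟨ cong (_+ suc d) (m∸n+n≡m i≤n) ⟩
        n + suc d             ≡⟨ +-comm n (suc d) ⟩
        suc d + n             ∎

    shift : ∀ k → power a (k * suc d + e) ≈ power a e
    shift zero    = ≈-refl
    shift (suc k) = ≈-trans
      (reflexive (cong (power a) (+-assoc (suc d) (k * suc d) e)))
      (≈-trans (period (k * suc d + e) (≤-trans i≤e (m≤n+m e (k * suc d)))) (shift k))

  finite-powers⇒idempotent : ∀ a L → (∀ n → power a n ∈ L) → ∃[ e ] e ∙ e ≈ e
  finite-powers⇒idempotent a L power∈L
    -- Among the first `length L + 1` powers, two occupy the same position of `L`.
    with i , j , i<j , eq ← pigeonhole (n<1+n (length L)) (λ i → Any.index (power∈L (toℕ i)))
    = power-idempotent a i<j (index-injective setoid (power∈L _) (power∈L _) eq)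

  -- Finite sums with control of the first and last index

  -- SumFrom x lo k z: z is the sum of x over a finite set of indices with
  -- minimum at least lo and maximum k.
  data SumFrom (x : ℕ → Carrier) (lo : ℕ) : ℕ → Pred Carrier (c ⊔ ℓ) where
    single : ∀ {n z} → lo ≤ n → z ≈ x n → SumFrom x lo n z
    snoc   : ∀ {k n w z} → SumFrom x lo k w → k < n → z ≈ w ∙ x n → SumFrom x lo n z

  module _ {x : ℕ → Carrier} where

    SumFrom-resp-≈ : ∀ {lo k} → SumFrom x lo k Respects _≈_
    SumFrom-resp-≈ z≈z′ (single lo≤n z≈)  = single lo≤n (≈-trans (≈-sym z≈z′) z≈)
    SumFrom-resp-≈ z≈z′ (snoc sum k<n z≈) = snoc sum k<n (≈-trans (≈-sym z≈z′) z≈)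

    SumFrom-weaken : ∀ {lo lo′ k z} → lo′ ≤ lo → SumFrom x lo k z → SumFrom x lo′ k z
    SumFrom-weaken lo′≤lo (single lo≤n z≈)  = single (≤-trans lo′≤lo lo≤n) z≈
    SumFrom-weaken lo′≤lo (snoc sum k<n z≈) = snoc (SumFrom-weaken lo′≤lo sum) k<n z≈

    SumFrom⇒≤ : ∀ {lo k z} → SumFrom x lo k z → lo ≤ k
    SumFrom⇒≤ (single lo≤n _)  = lo≤n
    SumFrom⇒≤ (snoc sum k<n _) = ≤-trans (SumFrom⇒≤ sum) (<⇒≤ k<n)

    SumFrom-∙ : ∀ {lo k lo′ n w z} → SumFrom x lo k w → k < lo′ → SumFrom x lo′ n z →
                SumFrom x lo n (w ∙ z)
    SumFrom-∙ sum k<lo′ (single lo′≤n z≈) =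
      snoc sum (<-≤-trans k<lo′ lo′≤n) (∙-congˡ z≈)
    SumFrom-∙ sum k<lo′ (snoc sum′ k′<n z≈) =
      snoc (SumFrom-∙ sum k<lo′ sum′) k′<n (≈-trans (∙-congˡ z≈) (≈-sym (assoc _ _ _)))

    FS⇒SumFrom : ∀ n ns → Increasing S (n ∷ ns) →
                 ∃[ k ] SumFrom x n k (foldr₁ _∙_ (List⁺.map x (n ∷ ns)))
    FS⇒SumFrom n []       [-]         = n , single ≤-refl ≈-refl
    FS⇒SumFrom n (m ∷ ns) (n<m ∷ inc) =
      let k , sum = FS⇒SumFrom m ns inc
      in  k , SumFrom-∙ (single ≤-refl ≈-refl) n<m sum

    -- `SumFrom` nests to the left and `FS` to the right, so the terms are moved one by one onto an
    -- accumulator `m ∷ ns`.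
    SumFrom-∙-FS : ∀ {lo k w m ns} → SumFrom x lo k w → k < m → Increasing S (m ∷ ns) →
                   FS S x (w ∙ foldr₁ _∙_ (List⁺.map x (m ∷ ns)))
    SumFrom-∙-FS {m = m} {ns} (single {n} _ w≈) n<m inc =
      n ∷ m ∷ ns , n<m ∷ inc , ∙-congʳ w≈
    SumFrom-∙-FS (snoc {n = n} sum k<n w≈) n<m inc =
      let H , incH , eq = SumFrom-∙-FS sum k<n (n<m ∷ inc)
      in  H , incH , ≈-trans (≈-trans (∙-congʳ w≈) (assoc _ _ _)) eq

    SumFrom⇒FS : ∀ {lo k z} → SumFrom x lo k z → FS S x z
    SumFrom⇒FS (single {n} _ z≈)    = n ∷ [] , [-] , z≈
    SumFrom⇒FS (snoc sum k<n z≈) =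
      let H , incH , eq = SumFrom-∙-FS sum k<n [-] in H , incH , ≈-trans z≈ eq

  SumFrom-blocks : ∀ {x y : ℕ → Carrier} (start stop : ℕ → ℕ) →
    (∀ n → SumFrom x (start n) (stop n) (y n)) → (∀ {m n} → m < n → stop m < start n) →
    ∀ {lo n z} → SumFrom y lo n z → SumFrom x 0 (stop n) z
  SumFrom-blocks start stop block apart (single _ z≈) =
    SumFrom-resp-≈ (≈-sym z≈) (SumFrom-weaken z≤n (block _))
  SumFrom-blocks start stop block apart (snoc sum k<n z≈) =
    SumFrom-resp-≈ (≈-sym z≈)
      (SumFrom-∙ (SumFrom-blocks start stop block apart sum) (apart k<n) (block _))

  -- Blocks of length one. The last index `f n` is kept because it will decide the part to which a
  -- sum belongs.
  SumFrom-subsequence : ∀ {x : ℕ → Carrier} (f : ℕ → ℕ) → (∀ {m n} → m < n → f m < f n) →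
                        ∀ {lo n z} → SumFrom (x ∘ f) lo n z → SumFrom x 0 (f n) z
  SumFrom-subsequence f f-mono = SumFrom-blocks f f (λ _ → single ≤-refl ≈-refl) f-mono

  -- Elements that are sums over every tail

  Recurrent : (ℕ → Carrier) → Pred Carrier (c ⊔ ℓ)
  Recurrent x a = ∀ m → ∃[ k ] SumFrom x m k a

  -- The sum for `b` is taken beyond the last index of the sum for `a`, so the two concatenate.
  Recurrent-∙ : ∀ {x a b} → Recurrent x a → Recurrent x b → Recurrent x (a ∙ b)
  Recurrent-∙ rec-a rec-b m =
    let k , sum  = rec-a m
        l , sum′ = rec-b (suc k)
    in  l , SumFrom-∙ sum ≤-refl sum′

  Recurrent-power : ∀ {x a} → Recurrent x a → ∀ n → Recurrent x (power a n)
  Recurrent-power rec-a zero    = rec-a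
  Recurrent-power rec-a (suc n) = Recurrent-∙ rec-a (Recurrent-power rec-a n)

  -- Fresh terms make the last index unique

  LastUnique : (ℕ → Carrier) → Set (c ⊔ ℓ)
  LastUnique y = ∀ {m n z} → SumFrom y 0 m z → SumFrom y 0 n z → m ≡ n

  -- The elements whose choice as next term y n would give a sum ending at n the
  -- value of an earlier one, where F lists the earlier sums.
  forbidden : LeftWeaklyCancellative S → List Carrier → List Carrier
  forbidden cancel F = F ++ concatMap (λ a → concatMap (λ b → proj₁ (cancel a b)) F) F

  ∈-forbidden : ∀ cancel F {a b z} → a ∈ F → b ∈ F → a ∙ z ≈ b → z ∈ forbidden cancel F
  ∈-forbidden cancel F {z = z} a∈F b∈F az≈b =
    ++⁺ʳ F (concatMap⁺ _ (Any.map (λ {a′} a≈a′ → concatMap⁺ _ (Any.map (λ {b′} b≈b′ →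
      proj₁ (proj₂ (cancel a′ b′)) {z} (≈-trans (∙-congʳ (≈-sym a≈a′)) (≈-trans az≈b b≈b′)))
      b∈F)) a∈F))

  -- If `F` lists the sums over indices below `n` and `z` is `y n`, the entries added are the sums
  -- with last index `n`.
  extend : List Carrier → Carrier → List Carrier
  extend F z = F ++ z ∷ map (_∙ z) F

  module _ (cancel : LeftWeaklyCancellative S) (y : ℕ → Carrier) (sums : ℕ → List Carrier)
           (sums-suc : ∀ n → sums (suc n) ≡ extend (sums n) (y n))
           (fresh : ∀ n → y n ∉ forbidden cancel (sums n)) where

    sums-mono : ∀ {m n z} → m ≤′ n → z ∈ sums m → z ∈ sums n
    sums-mono ≤′-refl       z∈ = z∈
    sums-mono (≤′-step m≤n) z∈ = subst (_ ∈_) (≡.sym (sums-suc _)) (++⁺ˡ (sums-mono m≤n z∈))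

    SumFrom⇒∈sums : ∀ {lo k n z} → SumFrom y lo k z → k < n → z ∈ sums n
    SumFrom⇒∈sums {k = k} sum k<n =
      sums-mono (≤⇒≤′ k<n) (subst (_ ∈_) (≡.sym (sums-suc k)) (++⁺ʳ (sums k) (∈-new sum)))
      where
      ∈-new : ∀ {lo k z} → SumFrom y lo k z → z ∈ y k ∷ map (_∙ y k) (sums k)
      ∈-new (single _ z≈)      = here z≈
      ∈-new (snoc sum k′<k z≈) = there (map⁺
        (Any.map (λ w≈ → ≈-trans z≈ (∙-congʳ w≈)) (SumFrom⇒∈sums sum k′<k)))

    -- Otherwise `y n` would be an earlier sum, or would solve an equation between two earlier sums,
    -- and so be forbidden.
    SumFrom⇒∉sums : ∀ {lo n z} → SumFrom y lo n z → z ∉ sums n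
    SumFrom⇒∉sums {n = n} (single _ z≈) z∈ = fresh n (++⁺ˡ (∈-resp-≈ setoid z≈ z∈))
    SumFrom⇒∉sums {n = n} (snoc sum k<n z≈) z∈ =
      fresh n (∈-forbidden cancel (sums n) (SumFrom⇒∈sums sum k<n) z∈ (≈-sym z≈))

    fresh⇒LastUnique : LastUnique y
    fresh⇒LastUnique {m} {n} sum sum′ with <-cmp m n
    ... | tri< m<n _ _ = contradiction (SumFrom⇒∈sums sum m<n) (SumFrom⇒∉sums sum′)
    ... | tri≈ _ m≡n _ = m≡n
    ... | tri> _ _ n<m = contradiction (SumFrom⇒∈sums sum′ n<m) (SumFrom⇒∉sums sum)

  module _ (em : ExcludedMiddle (c ⊔ ℓ)) where

    -- Choosing the blocks

    -- If the head of `L` is not recurrent, a later tail avoids it and the shorter list suffices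
    -- there. The list cannot run empty, since `x m` is itself a sum.
    finite-tail⇒recurrent : ∀ x L m → (∀ {k z} → SumFrom x m k z → z ∈ L) → ∃[ a ] Recurrent x a
    finite-tail⇒recurrent x []      m sums∈ with () ← sums∈ (single ≤-refl ≈-refl)
    finite-tail⇒recurrent x (b ∷ L) m sums∈ with em {Recurrent x b}
    ... | yes rec-b = b , rec-b
    ... | no ¬rec-b = finite-tail⇒recurrent x L (m ⊔ℕ m′) sums∈′
      where
      avoids-b : ∃[ m′ ] ¬ (∃[ k ] SumFrom x m′ k b)
      avoids-b = em⇒dne em λ none → ¬rec-b λ m′ → em⇒dne em λ ¬sum → none (m′ , ¬sum)

      m′ : ℕ
      m′ = proj₁ avoids-b

      sums∈′ : ∀ {k z} → SumFrom x (m ⊔ℕ m′) k z → z ∈ L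
      sums∈′ sum with sums∈ (SumFrom-weaken (m≤m⊔n m m′) sum)
      ... | there z∈L = z∈L
      ... | here z≈b  = contradiction
        (_ , SumFrom-resp-≈ z≈b (SumFrom-weaken (m≤n⊔m m m′) sum)) (proj₂ avoids-b)

    tail-escapes : NoIdempotent S → ∀ x m L → ∃[ z ] ∃[ k ] SumFrom x m k z × z ∉ L
    tail-escapes noIdem x m L = em⇒dne em λ none →
      let sums∈ : ∀ {k z} → SumFrom x m k z → z ∈ L
          sums∈ = λ sum → em⇒dne (lower-em c em) λ z∉L → none (_ , _ , sum , z∉L)
          a , rec-a  = finite-tail⇒recurrent x L m sums∈
          e , e-idem = finite-powers⇒idempotent a L λ n → sums∈ (proj₂ (Recurrent-power rec-a n m))
      in  noIdem e e-idem

    blocks-LastUnique : LeftWeaklyCancellative S → NoIdempotent S → ∀ x →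
                        ∃[ y ] (∀ {n z} → SumFrom y 0 n z → FS S x z) × LastUnique y
    blocks-LastUnique cancel noIdem x =
      y , SumFrom⇒FS ∘ SumFrom-blocks start stop block apart ,
      fresh⇒LastUnique cancel y sums (λ _ → refl) (λ n → proj₂ (proj₂ (proj₂ (next n))))
      where
      -- Simultaneous recursion: each block starts just past the end of the previous one, and its
      -- sum avoids what the sums listed so far forbid.
      start : ℕ → ℕ
      sums  : ℕ → List Carrier
      next  : ∀ n → ∃[ z ] ∃[ k ] SumFrom x (start n) k z × z ∉ forbidden cancel (sums n)

      start zero    = zero
      start (suc n) = suc (proj₁ (proj₂ (next n)))
      sums zero     = []
      sums (suc n)  = extend (sums n) (proj₁ (next n))
      next n        = tail-escapes noIdem x (start n) (forbidden cancel (sums n))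

      y : ℕ → Carrier
      y n = proj₁ (next n)

      stop : ℕ → ℕ
      stop n = proj₁ (proj₂ (next n))

      block : ∀ n → SumFrom x (start n) (stop n) (y n)
      block n = proj₁ (proj₂ (proj₂ (next n)))

      apart′ : ∀ {m n} → m <′ n → stop m < start n
      apart′ ≤′-refl       = ≤-refl
      apart′ (≤′-step m<n) = m≤n⇒m≤1+n (≤-trans (apart′ m<n) (SumFrom⇒≤ (block _)))

      apart : ∀ {m n} → m < n → stop m < start n
      apart = apart′ ∘ ≤⇒≤′

  module _ (em : ExcludedMiddle (c ⊔ ℓ)) {a} (A : Pred Carrier a) (A-resp : A Respects _≈_)
           (y : ℕ → Carrier) (sums⊆A : ∀ {n z} → SumFrom y 0 n z → A z)
           (last-unique : LastUnique y) where

    -- The partition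

    -- Only the last index must lie in the class; the other indices are free. Disjointness then
    -- follows from `last-unique`.
    Part : ℕ → Pred Carrier (c ⊔ ℓ)
    Part i z = ∃[ j ] SumFrom y 0 (class i j) z

    FS⊆Part : ∀ i {z} → FS S (y ∘ class i) z → Part i z
    FS⊆Part i (n ∷ ns , inc , z≈) =
      let k , sum = FS⇒SumFrom n ns inc
      in  k , SumFrom-resp-≈ (≈-sym z≈) (SumFrom-subsequence (class i) (class-mono-< i) sum)

    Part⊆A : ∀ i {z} → Part i z → A z
    Part⊆A i (j , sum) = sums⊆A sum

    Part-disjoint : ∀ {i i′ z} → Part i z → Part i′ z → i ≡ i′
    Part-disjoint {i} {i′} (j , sum) (j′ , sum′) =
      class-injective i i′ (last-unique sum sum′)

    Part-resp : ∀ i → Part i Respects _≈_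
    Part-resp i z≈z′ (j , sum) = j , SumFrom-resp-≈ z≈z′ sum

    -- Block zero takes all of `A` outside the later parts, so it absorbs the elements of `A` that
    -- are in no part and still contains `Part 0`.
    Block : ℕ → Pred Carrier (c ⊔ ℓ ⊔ a)
    Block zero    z = A z × (∀ i → ¬ Part (suc i) z)
    Block (suc i) z = A z × Part (suc i) z

    Block-resp : ∀ i → Block i Respects _≈_
    Block-resp zero    z≈z′ (Az , ¬p) =
      A-resp z≈z′ Az , λ i p → ¬p i (Part-resp (suc i) (≈-sym z≈z′) p)
    Block-resp (suc i) z≈z′ (Az , p) = A-resp z≈z′ Az , Part-resp (suc i) z≈z′ p

    Block-disjoint : ∀ {i j} → i ≢ j → Block i ⊥ Block j
    Block-disjoint {zero}  {zero}  i≢j _                     = i≢j refl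
    Block-disjoint {zero}  {suc j} _   ((_ , ¬p) , (_ , p))  = ¬p j p
    Block-disjoint {suc i} {zero}  _   ((_ , p) , (_ , ¬p))  = ¬p i p
    Block-disjoint {suc i} {suc j} i≢j ((_ , p) , (_ , p′))  = i≢j (Part-disjoint p p′)

    A⊆⋃Block : ∀ {z} → A z → ∃[ i ] Block i z
    A⊆⋃Block {z} Az with em {∃[ i ] Part (suc i) z}
    ... | yes (i , p) = suc i , Az , p
    ... | no ¬p       = zero , Az , λ i p → ¬p (i , p)

    Block⊆A : ∀ i {z} → Block i z → A z
    Block⊆A zero    = proj₁
    Block⊆A (suc i) = proj₁

    Block-isPartition : IsPartition S A Block
    Block-isPartition = record
      { respects = Block-resp
      ; disjoint = Block-disjoint
      ; union    = A⊆⋃Block , λ (i , b) → Block⊆A i b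
      }

    Part⊆Block : ∀ i {z} → Part i z → Block i z
    Part⊆Block zero    p = Part⊆A 0 p , λ i p′ → 0≢1+n (Part-disjoint {zero} {suc i} p p′)
    Part⊆Block (suc i) p = Part⊆A (suc i) p , p

    Block-isIP : ∀ i → IsIP S (Block i)
    Block-isIP i = y ∘ class i , λ fs → Part⊆Block i (FS⊆Part i fs)

theorem2p1 : ∀ {c ℓ a} → ExcludedMiddle (c ⊔ ℓ ⊔ a) →
    (S : Semigroup c ℓ) → let open Semigroup S in
    Infinite S → LeftWeaklyCancellative S → NoIdempotent S →
    (A : Pred Carrier a) → A Respects _≈_ → IsIP S A →
    Σ[ B ∈ (ℕ → Pred Carrier (c ⊔ ℓ ⊔ a)) ]
    IsPartition S A B × (∀ i → IsIP S (B i))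
theorem2p1 {a = a} em S _ cancel noIdem A A-resp (x , FS⊆A) =
  let em′ = lower-em a em
      y , sums⊆FS , last-unique = blocks-LastUnique S em′ cancel noIdem x
      sums⊆A = λ {n} {z} sum → FS⊆A (sums⊆FS {n} {z} sum)
  in  Block S em′ A A-resp y sums⊆A last-unique ,
      Block-isPartition S em′ A A-resp y sums⊆A last-unique ,
      Block-isIP S em′ A A-resp y sums⊆A last-unique
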